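{- Let $u\in\mathcal{F}_0$, $v\in\mathcal{F}_1$, and let $t_{n,k}=[x^n]u(x)v(x)^k$ be the $(n,k)$-element of the Riordan array $(u,v)$. Then for all $n\ge k\ge 0$ $$t_{n,k}=[x^{n-k}]\,g(x)f(x)^n,$$ where $$f(x)=\frac{x}{\operatorname{Rev}(v)(x)}\quad\text{and}\quad g(x)=f(x)\,\frac{u\left(\operatorname{Rev}(v)(x)\right)}{v'\left(\operatorname{Rev}(v)(x)\right)}.$$
   Context: All power series are formal power series in $x$ with coefficients in $\mathbb{Q}$. $\mathcal{F}_0$ is the set of series $a_0+a_1x+a_2x^2+\cdots$ with $a_0\neq 0$; $\mathcal{F}_1$ is the set of series $a_1x+a_2x^2+\cdots$ with $a_1\ne 0$. $[x^m]$ extracts the coefficient of $x^m$. For $v\in\mathcal{F}_1$, $\operatorname{Rev}(v)\in\mathcal{F}_1$ denotes its compositional inverse, and $v'$ its formal derivative. The quotient $x/w$ for $w\in\mathcal{F}_1$ is understood as a power series after cancelling the factor $x$. The Riordan array $(u,v)$ is the infinite lower-triangular matrix, indexed by $n,k\ge0$, with $(n,k)$ entry $[x^n]\,u(x)v(x)^k$. -}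

module Defs where

open import Algebra.Bundles using (CommutativeRing)
open import Data.Fin.Base using (Fin; toℕ)
open import Data.Fin.Properties using (toℕ<n; toℕ-inject₁; toℕ-fromℕ)
open import Data.Nat.Base as ℕ using (ℕ; zero; suc; s≤s; _∸_)
open import Data.Nat.Induction using (<-rec; <-wellFounded)
import Data.Nat.Properties as ℕ
open import Data.Rational.Base using (ℚ; 0ℚ; 1ℚ; _+_; _*_; _-_; _÷_; 1/_; NonZero; ≢-nonZero; +-0-rawMonoid)
open import Data.Rational.Properties
open import Data.Rational.Solver using (module +-*-Solver)
open import Function.Base using (_∘_)
open import Induction.WellFounded using (module FixPoint)
open import Relation.Binary.PropositionalEquality
  using (_≡_; _≢_; _≗_; refl; sym; trans; cong; cong₂; subst; module ≡-Reasoning)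

open import Algebra.Definitions.RawMonoid +-0-rawMonoid public using (_×_)
open import Algebra.Properties.Semiring.Sum (CommutativeRing.semiring +-*-commutativeRing) public
  using (sum-syntax; sum⁺-syntax; sum-cong-≗; ∑-distrib-+; *-distribˡ-sum; sum-init-last; sum-replicate-zero)

open ≡-Reasoning

-- Series are compared coefficientwise, by _≗_.
Series : Set
Series = ℕ → ℚ

infix 2 coeff
coeff : ℕ → Series → ℚ
coeff m a = a m

syntax coeff m a = [x^ m ] a

infixl 6 _⊕_
infixl 7 _⊛_
infixr 8 _^_
infixr 7 _·_

_⊕_ : Series → Series → Series
(a ⊕ b) n = a n + b n

_·_ : ℚ → Series → Series
(s · a) n = s * a n

_⊛_ : Series → Series → Series
(a ⊛ b) n = ∑[ i ≤ n ] (a (toℕ i) * b (n ∸ toℕ i))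

0ₛ : Series
0ₛ _ = 0ℚ

1ₛ : Series
1ₛ zero    = 1ℚ
1ₛ (suc _) = 0ℚ

X : Series
X zero    = 0ℚ
X (suc n) = 1ₛ n

_^_ : Series → ℕ → Series
a ^ zero  = 1ₛ
a ^ suc n = a ⊛ a ^ n

tail : Series → Series
tail a n = a (suc n)

record F₀ : Set where
  field
    series     : Series
    constant≢0 : series 0 ≢ 0ℚ

record F₁ : Set where
  field
    series     : Series
    constant≡0 : series 0 ≡ 0ℚ
    linear≢0   : series 1 ≢ 0ℚ

-- The composite a(b(x)) = Σₖ aₖ b(x)ᵏ. When b has no constant term, bᵏ has no
-- terms of degree below k, so only k ≤ n contribute to the coefficient of xⁿ.
-- It is meaningful only for such b.
compose : Series → Series → Series
compose a b n = ∑[ k ≤ n ] (a (toℕ k) * (b ^ toℕ k) n)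

-- (suc n × q) is the sum of (suc n) copies of q.
derivative : Series → Series
derivative a n = suc n × a (suc n)

⊛-cong : ∀ {a a′ b b′} → a ≗ a′ → b ≗ b′ → a ⊛ b ≗ a′ ⊛ b′
⊛-cong p q n = sum-cong-≗ {suc n} λ i → cong₂ _*_ (p (toℕ i)) (q (n ∸ toℕ i))

⊛-distribʳ : ∀ a b c → (a ⊕ b) ⊛ c ≗ (a ⊛ c) ⊕ (b ⊛ c)
⊛-distribʳ a b c n = trans
  (sum-cong-≗ {suc n} λ i → *-distribʳ-+ (c (n ∸ toℕ i)) (a (toℕ i)) (b (toℕ i)))
  (∑-distrib-+ {suc n} (λ i → a (toℕ i) * c (n ∸ toℕ i)) (λ i → b (toℕ i) * c (n ∸ toℕ i)))

·-⊛-assoc : ∀ s a b → (s · a) ⊛ b ≗ s · (a ⊛ b)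
·-⊛-assoc s a b n = trans
  (sum-cong-≗ {suc n} λ i → *-assoc s (a (toℕ i)) (b (n ∸ toℕ i)))
  (sym (*-distribˡ-sum {suc n} s (λ i → a (toℕ i) * b (n ∸ toℕ i))))

⊛-assoc : ∀ a b c → (a ⊛ b) ⊛ c ≗ a ⊛ (b ⊛ c)
⊛-assoc a b c zero =
  solve 3 (λ x y z → (x :* y :+ con 0ℚ) :* z :+ con 0ℚ := x :* (y :* z :+ con 0ℚ) :+ con 0ℚ)
    refl (a 0) (b 0) (c 0)
  where open +-*-Solver
⊛-assoc a b c (suc n) = begin
  (a 0 * b 0 + 0ℚ) * c (suc n) + (((a 0 · tail b) ⊕ (tail a ⊛ b)) ⊛ c) n
    ≡⟨ cong ((a 0 * b 0 + 0ℚ) * c (suc n) +_)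
         (trans (⊛-distribʳ (a 0 · tail b) (tail a ⊛ b) c n)
                (cong₂ _+_ (·-⊛-assoc (a 0) (tail b) c n) (⊛-assoc (tail a) b c n))) ⟩
  (a 0 * b 0 + 0ℚ) * c (suc n) + (a 0 * (tail b ⊛ c) n + (tail a ⊛ (b ⊛ c)) n)
    ≡⟨ solve 5 (λ x y z s t → (x :* y :+ con 0ℚ) :* z :+ (x :* s :+ t) := x :* (y :* z :+ s) :+ t)
         refl (a 0) (b 0) (c (suc n)) ((tail b ⊛ c) n) ((tail a ⊛ (b ⊛ c)) n) ⟩
  a 0 * (b 0 * c (suc n) + (tail b ⊛ c) n) + (tail a ⊛ (b ⊛ c)) n ∎
  where open +-*-Solver

∑-zero : ∀ {n} (f : Fin n → ℚ) → (∀ i → f i ≡ 0ℚ) → ∑[ i < n ] f i ≡ 0ℚ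
∑-zero {n} f f≡0 = trans (sum-cong-≗ {n} f≡0) (sum-replicate-zero n)

⊛-zeroˡ : ∀ b → 0ₛ ⊛ b ≗ 0ₛ
⊛-zeroˡ b n = ∑-zero {suc n} (λ i → 0ℚ * b (n ∸ toℕ i)) (λ i → *-zeroˡ (b (n ∸ toℕ i)))

⊛-identityˡ : ∀ b → 1ₛ ⊛ b ≗ b
⊛-identityˡ b zero    = trans (+-identityʳ _) (*-identityˡ (b 0))
⊛-identityˡ b (suc n) =
  trans (cong₂ _+_ (*-identityˡ (b (suc n))) (⊛-zeroˡ b n)) (+-identityʳ _)

X⊛-suc : ∀ b n → (X ⊛ b) (suc n) ≡ b n
X⊛-suc b n = trans (cong₂ _+_ (*-zeroˡ (b (suc n))) (⊛-identityˡ b n)) (+-identityˡ (b n))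

⊛-lowest : ∀ a b n → (∀ m → m ℕ.< n → b m ≡ 0ℚ) → (a ⊛ b) n ≡ a 0 * b n
⊛-lowest a b zero    _  = +-identityʳ _
⊛-lowest a b (suc n) b≡0 = trans
  (cong (a 0 * b (suc n) +_)
    (∑-zero {suc n} (λ i → a (suc (toℕ i)) * b (n ∸ toℕ i))
      (λ i → trans (cong (a (suc (toℕ i)) *_) (b≡0 (n ∸ toℕ i) (s≤s (ℕ.m∸n≤m n (toℕ i)))))
                   (*-zeroʳ (a (suc (toℕ i)))))))
  (+-identityʳ _)

⊛-shift : ∀ a b → a 0 ≡ 0ℚ → ∀ n → (a ⊛ b) (suc n) ≡ (tail a ⊛ b) n
⊛-shift a b a₀≡0 n = begin
  a 0 * b (suc n) + (tail a ⊛ b) n  ≡⟨ cong (λ z → z * b (suc n) + (tail a ⊛ b) n) a₀≡0 ⟩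
  0ℚ * b (suc n) + (tail a ⊛ b) n   ≡⟨ cong (_+ (tail a ⊛ b) n) (*-zeroˡ (b (suc n))) ⟩
  0ℚ + (tail a ⊛ b) n               ≡⟨ +-identityˡ _ ⟩
  (tail a ⊛ b) n                    ∎

⊛-zero₀ : ∀ a b → a 0 ≡ 0ℚ → (a ⊛ b) 0 ≡ 0ℚ
⊛-zero₀ a b a₀≡0 = trans (+-identityʳ _) (trans (cong (_* b 0) a₀≡0) (*-zeroˡ (b 0)))

⊛-cong-< : ∀ a {b c} → a 0 ≡ 0ℚ → ∀ n → (∀ m → m ℕ.< n → b m ≡ c m) → (a ⊛ b) n ≡ (a ⊛ c) n
⊛-cong-< a {b} {c} a₀≡0 zero    _   = trans (⊛-zero₀ a b a₀≡0) (sym (⊛-zero₀ a c a₀≡0))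
⊛-cong-< a {b} {c} a₀≡0 (suc n) b≡c = begin
  (a ⊛ b) (suc n)  ≡⟨ ⊛-shift a b a₀≡0 n ⟩
  (tail a ⊛ b) n   ≡⟨ sum-cong-≗ {suc n} (λ i → cong (a (suc (toℕ i)) *_)
                        (b≡c (n ∸ toℕ i) (s≤s (ℕ.m∸n≤m n (toℕ i))))) ⟩
  (tail a ⊛ c) n   ≡⟨ ⊛-shift a c a₀≡0 n ⟨
  (a ⊛ c) (suc n)  ∎

*-≢0 : ∀ {p q} → p ≢ 0ℚ → q ≢ 0ℚ → p * q ≢ 0ℚ
*-≢0 {p} {q} p≢0 q≢0 pq≡0 = q≢0 (begin
  q              ≡⟨ *-identityˡ q ⟨
  1ℚ * q         ≡⟨ cong (_* q) (*-inverseˡ p) ⟨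
  1/ p * p * q   ≡⟨ *-assoc (1/ p) p q ⟩
  1/ p * (p * q) ≡⟨ cong (1/ p *_) pq≡0 ⟩
  1/ p * 0ℚ      ≡⟨ *-zeroʳ (1/ p) ⟩
  0ℚ             ∎)
  where instance
    p-nonZero : NonZero p
    p-nonZero = ≢-nonZero p≢0

^-below : ∀ a → a 0 ≡ 0ℚ → ∀ k n → n ℕ.< k → (a ^ k) n ≡ 0ℚ
^-below a a₀≡0 (suc k) zero    _         = ⊛-zero₀ a (a ^ k) a₀≡0
^-below a a₀≡0 (suc k) (suc n) (s≤s n<k) = begin
  (a ⊛ a ^ k) (suc n)   ≡⟨ ⊛-shift a (a ^ k) a₀≡0 n ⟩
  (tail a ⊛ a ^ k) n    ≡⟨ ⊛-lowest (tail a) (a ^ k) n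
                             (λ m m<n → ^-below a a₀≡0 k m (ℕ.<-trans m<n n<k)) ⟩
  a 1 * (a ^ k) n       ≡⟨ cong (a 1 *_) (^-below a a₀≡0 k n n<k) ⟩
  a 1 * 0ℚ              ≡⟨ *-zeroʳ (a 1) ⟩
  0ℚ                    ∎

^-diagonal≢0 : ∀ a → a 0 ≡ 0ℚ → a 1 ≢ 0ℚ → ∀ n → (a ^ n) n ≢ 0ℚ
^-diagonal≢0 a a₀≡0 a₁≢0 zero    = 1≢0
^-diagonal≢0 a a₀≡0 a₁≢0 (suc n) p≡0 =
  *-≢0 a₁≢0 (^-diagonal≢0 a a₀≡0 a₁≢0 n) (begin
    a 1 * (a ^ n) n       ≡⟨ ⊛-lowest (tail a) (a ^ n) n (λ m → ^-below a a₀≡0 n m) ⟨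
    (tail a ⊛ a ^ n) n    ≡⟨ ⊛-shift a (a ^ n) a₀≡0 n ⟨
    (a ⊛ a ^ n) (suc n)   ≡⟨ p≡0 ⟩
    0ℚ                    ∎)

-- The solution s of  Σ_{i ≤ n} sᵢ M(n,i) = rₙ  (n ≥ 0), by forward substitution.
forwardSubstStep : (M : ℕ → ℕ → ℚ) → (∀ n → M n n ≢ 0ℚ) → Series →
                   ∀ n → (∀ {i} → i ℕ.< n → ℚ) → ℚ
forwardSubstStep M diag≢0 r n s =
  (r n - ∑[ i < n ] (s (toℕ<n i) * M n (toℕ i))) ÷ M n n
  where instance
    diag-nonZero : NonZero (M n n)
    diag-nonZero = ≢-nonZero (diag≢0 n)

forwardSubst : (M : ℕ → ℕ → ℚ) → (∀ n → M n n ≢ 0ℚ) → Series → Series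
forwardSubst M diag≢0 r = <-rec (λ _ → ℚ) (forwardSubstStep M diag≢0 r)

∑-last : ∀ n (f : ℕ → ℚ) → ∑[ i ≤ n ] f (toℕ i) ≡ ∑[ i < n ] f (toℕ i) + f n
∑-last n f = trans (sum-init-last {n} (f ∘ toℕ))
  (cong₂ _+_ (sum-cong-≗ {n} (λ i → cong f (toℕ-inject₁ i))) (cong f (toℕ-fromℕ n)))

÷-cancel : ∀ p d → (d≢0 : d ≢ 0ℚ) → (p ÷ d) {{≢-nonZero d≢0}} * d ≡ p
÷-cancel p d d≢0 = begin
  p * 1/ d * d    ≡⟨ *-assoc p (1/ d) d ⟩
  p * (1/ d * d)  ≡⟨ cong (p *_) (*-inverseˡ d) ⟩
  p * 1ℚ          ≡⟨ *-identityʳ p ⟩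
  p               ∎
  where instance
    d-nonZero : NonZero d
    d-nonZero = ≢-nonZero d≢0

forwardSubst-solves : ∀ M diag≢0 r n →
  ∑[ i ≤ n ] (forwardSubst M diag≢0 r (toℕ i) * M n (toℕ i)) ≡ r n
forwardSubst-solves M diag≢0 r n = begin
  ∑[ i ≤ n ] (s (toℕ i) * M n (toℕ i))
    ≡⟨ ∑-last n (λ i → s i * M n i) ⟩
  S + s n * M n n
    ≡⟨ cong (λ z → S + z * M n n) unfold ⟩
  S + forwardSubstStep M diag≢0 r n (λ {i} _ → s i) * M n n
    ≡⟨ cong (S +_) (÷-cancel (r n - S) (M n n) (diag≢0 n)) ⟩
  S + (r n - S)
    ≡⟨ solve 2 (λ x y → x :+ (y :- x) := y) refl S (r n) ⟩
  r n ∎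
  where
  open +-*-Solver
  s = forwardSubst M diag≢0 r
  S = ∑[ i < n ] (s (toℕ i) * M n (toℕ i))
  unfold : s n ≡ forwardSubstStep M diag≢0 r n (λ {i} _ → s i)
  unfold = FixPoint.unfold-wfRec <-wellFounded (λ _ → ℚ) (forwardSubstStep M diag≢0 r)
    (λ m {s₁} {s₂} eq → cong (λ z → ((r m - z) ÷ M m m) {{≢-nonZero (diag≢0 m)}})
      (sum-cong-≗ {m} λ i → cong (_* M m (toℕ i)) (eq (toℕ<n i)))) {n}

toeplitz : Series → ℕ → ℕ → ℚ
toeplitz a n i = a (n ∸ i)

toeplitz-diagonal≢0 : ∀ a → a 0 ≢ 0ℚ → ∀ n → toeplitz a n n ≢ 0ℚ
toeplitz-diagonal≢0 a a₀≢0 n = subst (λ m → a m ≢ 0ℚ) (sym (ℕ.n∸n≡0 n)) a₀≢0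

recip : F₀ → Series
recip a = forwardSubst (toeplitz (F₀.series a))
  (toeplitz-diagonal≢0 (F₀.series a) (F₀.constant≢0 a)) 1ₛ

recip-inverse : ∀ a → recip a ⊛ F₀.series a ≗ 1ₛ
recip-inverse a = forwardSubst-solves (toeplitz (F₀.series a))
  (toeplitz-diagonal≢0 (F₀.series a) (F₀.constant≢0 a)) 1ₛ

infixl 7 _⊘_
_⊘_ : Series → F₀ → Series
a ⊘ b = a ⊛ recip b

-- The quotient x / w, after cancelling x.
x/_ : F₁ → Series
x/ w = 1ₛ ⊘ record { series = tail (F₁.series w) ; constant≢0 = F₁.linear≢0 w }

compose-cong : ∀ {a a′} b → a ≗ a′ → compose a b ≗ compose a′ b
compose-cong b a≗a′ n = sum-cong-≗ {suc n} λ k → cong (_* (b ^ toℕ k) n) (a≗a′ (toℕ k))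

^-cong : ∀ {b b′} → b ≗ b′ → ∀ k → b ^ k ≗ b′ ^ k
^-cong b≗b′ zero    n = refl
^-cong b≗b′ (suc k) n = ⊛-cong b≗b′ (^-cong b≗b′ k) n

compose-congʳ : ∀ a {b b′} → b ≗ b′ → compose a b ≗ compose a b′
compose-congʳ a b≗b′ n = sum-cong-≗ {suc n} λ k → cong (a (toℕ k) *_) (^-cong b≗b′ (toℕ k) n)

compose-⊕ : ∀ a b c → compose (a ⊕ b) c ≗ compose a c ⊕ compose b c
compose-⊕ a b c n = trans
  (sum-cong-≗ {suc n} λ k → *-distribʳ-+ ((c ^ toℕ k) n) (a (toℕ k)) (b (toℕ k)))
  (∑-distrib-+ {suc n} (λ k → a (toℕ k) * (c ^ toℕ k) n) (λ k → b (toℕ k) * (c ^ toℕ k) n))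

compose-· : ∀ s a b → compose (s · a) b ≗ s · compose a b
compose-· s a b n = trans
  (sum-cong-≗ {suc n} λ k → *-assoc s (a (toℕ k)) ((b ^ toℕ k) n))
  (sym (*-distribˡ-sum {suc n} s (λ k → a (toℕ k) * (b ^ toℕ k) n)))

⊛-∑ : ∀ a N (c : ℕ → ℚ) (p : ℕ → Series) n →
  (a ⊛ (λ m → ∑[ k < N ] (c (toℕ k) * p (toℕ k) m))) n ≡ ∑[ k < N ] (c (toℕ k) * (a ⊛ p (toℕ k)) n)
⊛-∑ a zero c p n = ∑-zero {suc n} (λ i → a (toℕ i) * 0ℚ) (λ i → *-zeroʳ (a (toℕ i)))
⊛-∑ a (suc N) c p n = begin
  (a ⊛ (λ m → c 0 * p 0 m + rest m)) n
    ≡⟨ sum-cong-≗ {suc n} (λ i → solve 4 (λ x y z t → x :* (y :* z :+ t) := y :* (x :* z) :+ x :* t)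
         refl (a (toℕ i)) (c 0) (p 0 (n ∸ toℕ i)) (rest (n ∸ toℕ i))) ⟩
  (∑[ i ≤ n ] (c 0 * (a (toℕ i) * p 0 (n ∸ toℕ i)) + a (toℕ i) * rest (n ∸ toℕ i)))
    ≡⟨ ∑-distrib-+ {suc n} (λ i → c 0 * (a (toℕ i) * p 0 (n ∸ toℕ i))) (λ i → a (toℕ i) * rest (n ∸ toℕ i)) ⟩
  (∑[ i ≤ n ] (c 0 * (a (toℕ i) * p 0 (n ∸ toℕ i)))) + (a ⊛ rest) n
    ≡⟨ cong₂ _+_ (sym (*-distribˡ-sum {suc n} (c 0) (λ i → a (toℕ i) * p 0 (n ∸ toℕ i))))
                 (⊛-∑ a N (c ∘ suc) (p ∘ suc) n) ⟩
  c 0 * (a ⊛ p 0) n + ∑[ k < N ] (c (suc (toℕ k)) * (a ⊛ p (suc (toℕ k))) n) ∎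
  where
  open +-*-Solver
  rest : Series
  rest m = ∑[ k < N ] (c (suc (toℕ k)) * p (suc (toℕ k)) m)

-- Terms beyond the n-th do not contribute.
compose-pad : ∀ a b → b 0 ≡ 0ℚ → ∀ d n →
  ∑[ k < d ℕ.+ suc n ] (a (toℕ k) * (b ^ toℕ k) n) ≡ compose a b n
compose-pad a b b₀≡0 zero    n = refl
compose-pad a b b₀≡0 (suc d) n = begin
  ∑[ k ≤ d ℕ.+ suc n ] (a (toℕ k) * (b ^ toℕ k) n)
    ≡⟨ ∑-last (d ℕ.+ suc n) (λ k → a k * (b ^ k) n) ⟩
  ∑[ k < d ℕ.+ suc n ] (a (toℕ k) * (b ^ toℕ k) n) + a (d ℕ.+ suc n) * (b ^ (d ℕ.+ suc n)) n
    ≡⟨ cong₂ _+_ (compose-pad a b b₀≡0 d n)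
         (trans (cong (a (d ℕ.+ suc n) *_) (^-below b b₀≡0 (d ℕ.+ suc n) n (ℕ.m≤n+m (suc n) d)))
                (*-zeroʳ (a (d ℕ.+ suc n)))) ⟩
  compose a b n + 0ℚ
    ≡⟨ +-identityʳ _ ⟩
  compose a b n ∎

compose-upTo : ∀ a b → b 0 ≡ 0ℚ → ∀ {n N} → n ℕ.< N →
  ∑[ k < N ] (a (toℕ k) * (b ^ toℕ k) n) ≡ compose a b n
compose-upTo a b b₀≡0 {n} {N} n<N =
  subst (λ N → ∑[ k < N ] (a (toℕ k) * (b ^ toℕ k) n) ≡ compose a b n)
    (ℕ.m∸n+n≡m n<N) (compose-pad a b b₀≡0 (N ∸ suc n) n)

compose-horner : ∀ a b → b 0 ≡ 0ℚ → compose a b ≗ (a 0 · 1ₛ) ⊕ (b ⊛ compose (tail a) b)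
compose-horner a b b₀≡0 n = cong (a 0 * 1ₛ n +_) (begin
  ∑[ k < n ] (a (suc (toℕ k)) * (b ⊛ b ^ toℕ k) n)
    ≡⟨ ⊛-∑ b n (tail a) (b ^_) n ⟨
  (b ⊛ (λ m → ∑[ k < n ] (a (suc (toℕ k)) * (b ^ toℕ k) m))) n
    ≡⟨ ⊛-cong-< b b₀≡0 n (λ m m<n → compose-upTo (tail a) b b₀≡0 m<n) ⟩
  (b ⊛ compose (tail a) b) n ∎)

compose-zero : ∀ a b → compose a b 0 ≡ a 0
compose-zero a b = trans (+-identityʳ _) (*-identityʳ (a 0))

compose-⊛ : ∀ a b c → c 0 ≡ 0ℚ → compose (a ⊛ b) c ≗ compose a c ⊛ compose b c
compose-⊛ a b c c₀≡0 n = <-rec (λ n → ∀ a → compose (a ⊛ b) c n ≡ (compose a c ⊛ compose b c) n)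
  (λ n ih a → begin
    compose (a ⊛ b) c n
      ≡⟨ compose-cong c (split a) n ⟩
    compose ((a 0 · b) ⊕ (X ⊛ (tail a ⊛ b))) c n
      ≡⟨ compose-⊕ (a 0 · b) (X ⊛ (tail a ⊛ b)) c n ⟩
    compose (a 0 · b) c n + compose (X ⊛ (tail a ⊛ b)) c n
      ≡⟨ cong₂ _+_ (compose-· (a 0) b c n) (compose-X⊛ (tail a ⊛ b) n) ⟩
    a 0 * compose b c n + (c ⊛ compose (tail a ⊛ b) c) n
      ≡⟨ cong (a 0 * compose b c n +_)
           (⊛-cong-< c c₀≡0 n (λ m m<n → ih m<n (tail a))) ⟩
    a 0 * compose b c n + (c ⊛ (compose (tail a) c ⊛ compose b c)) n
      ≡⟨ cong₂ _+_
           (trans (·-⊛-assoc (a 0) 1ₛ (compose b c) n) (cong (a 0 *_) (⊛-identityˡ (compose b c) n)))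
           (⊛-assoc c (compose (tail a) c) (compose b c) n) ⟨
    ((a 0 · 1ₛ) ⊛ compose b c) n + ((c ⊛ compose (tail a) c) ⊛ compose b c) n
      ≡⟨ ⊛-distribʳ (a 0 · 1ₛ) (c ⊛ compose (tail a) c) (compose b c) n ⟨
    (((a 0 · 1ₛ) ⊕ (c ⊛ compose (tail a) c)) ⊛ compose b c) n
      ≡⟨ ⊛-cong {b = compose b c} {b′ = compose b c} (compose-horner a c c₀≡0) (λ _ → refl) n ⟨
    (compose a c ⊛ compose b c) n ∎)
  n a
  where
  split : ∀ a → a ⊛ b ≗ (a 0 · b) ⊕ (X ⊛ (tail a ⊛ b))
  split a zero    = cong (a 0 * b 0 +_) (sym (⊛-zero₀ X (tail a ⊛ b) refl))
  split a (suc n) = cong (a 0 * b (suc n) +_) (sym (X⊛-suc (tail a ⊛ b) n))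
  compose-X⊛ : ∀ a → compose (X ⊛ a) c ≗ c ⊛ compose a c
  compose-X⊛ a n = begin
    compose (X ⊛ a) c n
      ≡⟨ compose-horner (X ⊛ a) c c₀≡0 n ⟩
    (X ⊛ a) 0 * 1ₛ n + (c ⊛ compose (tail (X ⊛ a)) c) n
      ≡⟨ cong₂ _+_ (trans (cong (_* 1ₛ n) (⊛-zero₀ X a refl)) (*-zeroˡ (1ₛ n)))
                   (⊛-cong {c} {c} (λ _ → refl) (compose-cong c (X⊛-suc a)) n) ⟩
    0ℚ + (c ⊛ compose a c) n
      ≡⟨ +-identityˡ _ ⟩
    (c ⊛ compose a c) n ∎

compose-const : ∀ s c → compose (s · 1ₛ) c ≗ s · 1ₛ
compose-const s c n = begin
  s * 1ℚ * 1ₛ n + ∑[ k < n ] (s * 0ℚ * (c ^ suc (toℕ k)) n)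
    ≡⟨ cong₂ _+_ (cong (_* 1ₛ n) (*-identityʳ s))
         (∑-zero {n} (λ k → s * 0ℚ * (c ^ suc (toℕ k)) n)
           (λ k → trans (cong (_* (c ^ suc (toℕ k)) n) (*-zeroʳ s)) (*-zeroˡ ((c ^ suc (toℕ k)) n)))) ⟩
  s * 1ₛ n + 0ℚ
    ≡⟨ +-identityʳ _ ⟩
  s * 1ₛ n ∎

compose-assoc : ∀ a b c → b 0 ≡ 0ℚ → c 0 ≡ 0ℚ →
                compose (compose a b) c ≗ compose a (compose b c)
compose-assoc a b c b₀≡0 c₀≡0 n =
  <-rec (λ n → ∀ a → compose (compose a b) c n ≡ compose a (compose b c) n)
  (λ n ih a → begin
    compose (compose a b) c n
      ≡⟨ compose-cong c (compose-horner a b b₀≡0) n ⟩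
    compose ((a 0 · 1ₛ) ⊕ (b ⊛ compose (tail a) b)) c n
      ≡⟨ compose-⊕ (a 0 · 1ₛ) (b ⊛ compose (tail a) b) c n ⟩
    compose (a 0 · 1ₛ) c n + compose (b ⊛ compose (tail a) b) c n
      ≡⟨ cong₂ _+_ (compose-const (a 0) c n) (compose-⊛ b (compose (tail a) b) c c₀≡0 n) ⟩
    a 0 * 1ₛ n + (compose b c ⊛ compose (compose (tail a) b) c) n
      ≡⟨ cong (a 0 * 1ₛ n +_) (⊛-cong-< (compose b c) bc₀≡0 n (λ m m<n → ih m<n (tail a))) ⟩
    a 0 * 1ₛ n + (compose b c ⊛ compose (tail a) (compose b c)) n
      ≡⟨ compose-horner a (compose b c) bc₀≡0 n ⟨
    compose a (compose b c) n ∎)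
  n a
  where
  bc₀≡0 : compose b c 0 ≡ 0ℚ
  bc₀≡0 = trans (compose-zero b c) b₀≡0

compose-identityʳ : ∀ a → compose a X ≗ a
compose-identityʳ a zero    = compose-zero a X
compose-identityʳ a (suc n) = begin
  compose a X (suc n)                                    ≡⟨ compose-horner a X refl (suc n) ⟩
  a 0 * 0ℚ + (X ⊛ compose (tail a) X) (suc n)            ≡⟨ cong₂ _+_ (*-zeroʳ (a 0)) (X⊛-suc (compose (tail a) X) n) ⟩
  0ℚ + compose (tail a) X n                              ≡⟨ +-identityˡ _ ⟩
  compose (tail a) X n                                   ≡⟨ compose-identityʳ (tail a) n ⟩
  a (suc n)                                              ∎

compose-identityˡ : ∀ b → b 0 ≡ 0ℚ → compose X b ≗ b
compose-identityˡ b b₀≡0 zero    = trans (compose-zero X b) (sym b₀≡0)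
compose-identityˡ b b₀≡0 (suc n) = begin
  compose X b (suc n)                          ≡⟨ compose-horner X b b₀≡0 (suc n) ⟩
  0ℚ * 0ℚ + (b ⊛ compose 1ₛ b) (suc n)         ≡⟨ cong (_+ (b ⊛ compose 1ₛ b) (suc n)) (*-zeroˡ 0ℚ) ⟩
  0ℚ + (b ⊛ compose 1ₛ b) (suc n)              ≡⟨ +-identityˡ _ ⟩
  (b ⊛ compose 1ₛ b) (suc n)                   ≡⟨ ⊛-cong {b} {b} (λ _ → refl) compose-1 (suc n) ⟩
  (b ⊛ 1ₛ) (suc n)                             ≡⟨ ⊛-identityʳ b (suc n) ⟩
  b (suc n)                                    ∎
  where
  compose-1 : compose 1ₛ b ≗ 1ₛ
  compose-1 m = begin
    compose 1ₛ b m        ≡⟨ compose-cong b (λ j → sym (*-identityˡ (1ₛ j))) m ⟩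
    compose (1ℚ · 1ₛ) b m ≡⟨ compose-const 1ℚ b m ⟩
    1ℚ * 1ₛ m             ≡⟨ *-identityˡ (1ₛ m) ⟩
    1ₛ m                  ∎
  ⊛-identityʳ : ∀ a → a ⊛ 1ₛ ≗ a
  ⊛-identityʳ a zero    = trans (+-identityʳ _) (*-identityʳ (a 0))
  ⊛-identityʳ a (suc m) =
    trans (cong₂ _+_ (*-zeroʳ (a 0)) (⊛-identityʳ (tail a) m)) (+-identityˡ (a (suc m)))

-- The equations [xⁿ] w(v(x)) = [xⁿ] x form a triangular system for the
-- coefficients of w, with diagonal [xⁿ] v(x)ⁿ.
revSeries : F₁ → Series
revSeries v = forwardSubst (λ n k → (F₁.series v ^ k) n)
  (^-diagonal≢0 (F₁.series v) (F₁.constant≡0 v) (F₁.linear≢0 v)) X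

revSeries-inverseˡ : ∀ v → compose (revSeries v) (F₁.series v) ≗ X
revSeries-inverseˡ v = forwardSubst-solves (λ n k → (F₁.series v ^ k) n)
  (^-diagonal≢0 (F₁.series v) (F₁.constant≡0 v) (F₁.linear≢0 v)) X

Rev : F₁ → F₁
Rev v = record
  { series     = revSeries v
  ; constant≡0 = trans (sym (compose-zero (revSeries v) (F₁.series v))) (revSeries-inverseˡ v 0)
  ; linear≢0   = λ w₁≡0 → 1≢0 (begin
      1ℚ
        ≡⟨ revSeries-inverseˡ v 1 ⟨
      revSeries v 0 * 0ℚ + (revSeries v 1 * (F₁.series v ^ 1) 1 + 0ℚ)
        ≡⟨ cong₂ _+_ (*-zeroʳ (revSeries v 0))
             (trans (+-identityʳ _) (trans (cong (_* (F₁.series v ^ 1) 1) w₁≡0) (*-zeroˡ ((F₁.series v ^ 1) 1)))) ⟩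
      0ℚ + 0ℚ
        ≡⟨ +-identityˡ 0ℚ ⟩
      0ℚ ∎)
  }

Rev-inverseˡ : ∀ v → compose (F₁.series (Rev v)) (F₁.series v) ≗ X
Rev-inverseˡ = revSeries-inverseˡ

Rev-inverseʳ : ∀ v → compose (F₁.series v) (F₁.series (Rev v)) ≗ X
Rev-inverseʳ v n = begin
  compose v̂ w n  ≡⟨ compose-cong w v̂≗w′ n ⟩
  compose w′ w n ≡⟨ Rev-inverseˡ (Rev v) n ⟩
  X n            ∎
  where
  v̂ = F₁.series v
  w = F₁.series (Rev v)
  w′ = F₁.series (Rev (Rev v))
  v̂≗w′ : v̂ ≗ w′
  v̂≗w′ m = begin
    v̂ m                         ≡⟨ compose-identityˡ v̂ (F₁.constant≡0 v) m ⟨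
    compose X v̂ m               ≡⟨ compose-cong v̂ (Rev-inverseˡ (Rev v)) m ⟨
    compose (compose w′ w) v̂ m  ≡⟨ compose-assoc w′ w v̂ (F₁.constant≡0 (Rev v)) (F₁.constant≡0 v) m ⟩
    compose w′ (compose w v̂) m  ≡⟨ compose-congʳ w′ (Rev-inverseˡ v) m ⟩
    compose w′ X m              ≡⟨ compose-identityʳ w′ m ⟩
    w′ m                        ∎

infix 9 _⟨_⟩ _′

_⟨_⟩ : F₀ → F₁ → F₀
a ⟨ b ⟩ = record
  { series     = compose (F₀.series a) (F₁.series b)
  ; constant≢0 = subst (_≢ 0ℚ) (sym (compose-zero (F₀.series a) (F₁.series b))) (F₀.constant≢0 a)
  }

_′ : F₁ → F₀
v ′ = record
  { series     = derivative (F₁.series v)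
  ; constant≢0 = subst (_≢ 0ℚ) (sym (+-identityʳ _)) (F₁.linear≢0 v)
  }

riordan : F₀ → F₁ → ℕ → ℕ → ℚ
riordan u v n k = [x^ n ] (F₀.series u ⊛ F₁.series v ^ k)

{-# OPTIONS --safe #-}

-- Write w = Rev(v), so that f w = x, and let θ = x d/dx. The chain rule applied
-- to v(w(x)) = x gives x / v′(w) = θw, so by the substitution a = u vᵏ the claim
-- becomes the Lagrange inversion formula
--   aₙ = [xⁿ⁺¹] a(w(x)) θw(x) f(x)ⁿ⁺¹.
-- As a(w) = a₀ + w · ā(w) with ā = (a - a₀) / x, and w f = x, it follows by
-- induction on n from the case a = 1, in which [xᵐ⁺¹] fᵐ⁺¹ θw = [m = 0]. To see
-- the latter, apply θ to f w = x: this gives fᵐ⁺¹ θw + fᵐ w θf = x fᵐ, and for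
-- m > 0 both fᵐ w θf = x fᵐ⁻¹ θf and x fᵐ have the same coefficient of xᵐ⁺¹,
-- because m fᵐ⁻¹ θf = θ(fᵐ).
module Submission where

open import Data.Nat.Base using (ℕ; _≤_; _∸_)
open import Relation.Binary.PropositionalEquality using (_≡_)
open import Defs

open import Algebra.Bundles using (CommutativeMonoid; CommutativeRing; CommutativeSemiring)
import Algebra.Construct.Pointwise as Pointwise
import Algebra.Properties.CommutativeMonoid.Mult as CommutativeMonoidMult
import Algebra.Properties.Group as GroupProperties
import Algebra.Properties.Semiring.Mult as SemiringMult
import Algebra.Solver.Ring.NaturalCoefficients.Default as NaturalCoefficients
open import Algebra.Structures using (IsCommutativeMonoid)
open import Algebra.Structures.Biased using (isCommutativeMonoidˡ; isCommutativeSemiringˡ)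
open import Data.Fin.Base using (Fin; toℕ)
open import Data.Fin.Properties using (toℕ≤pred[n])
import Data.Nat.Base as ℕ
open import Data.Nat.Base using (zero; suc; z≤n; s≤s)
open import Data.Nat.Induction using (<-rec)
import Data.Nat.Properties as ℕ
open import Data.Rational.Base as ℚ using (ℚ; 0ℚ; 1ℚ; _+_; _*_; Positive)
open import Data.Rational.Properties
open import Data.Rational.Solver using (module +-*-Solver)
open import Level using (0ℓ)
open import Relation.Binary.PropositionalEquality
  using (_≗_; refl; sym; trans; cong; cong₂; module ≡-Reasoning)
import Relation.Binary.Reasoning.Setoid as SetoidReasoning

-- Natural multiples of rationals.

private
  module ℚ× where
    open SemiringMult (CommutativeRing.semiring +-*-commutativeRing) public
      using (×-comm-*; ×-assoc-*; ×-homo-+)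
    open CommutativeMonoidMult +-0-commutativeMonoid public using (×-distrib-+)

×-zeroʳ : ∀ n → n × 0ℚ ≡ 0ℚ
×-zeroʳ zero    = refl
×-zeroʳ (suc n) = trans (+-identityˡ (n × 0ℚ)) (×-zeroʳ n)

-- A multiple is a product with the positive rational `suc n × 1ℚ`, which cancels from `≤`;
-- antisymmetry turns the two inequalities into an equality.
×-cancelˡ : ∀ n {p q} → suc n × p ≡ suc n × q → p ≡ q
×-cancelˡ n {p} {q} eq = ≤-antisym (cancel eq) (cancel (sym eq))
  where
  positive : ∀ n → Positive (suc n × 1ℚ)
  positive zero    = _
  positive (suc n) = pos+pos⇒pos 1ℚ (suc n × 1ℚ) {{positive n}}
  scale : ∀ p → (suc n × 1ℚ) * p ≡ suc n × p
  scale p = trans (ℚ×.×-assoc-* (suc n) 1ℚ p) (cong (suc n ×_) (*-identityˡ p))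
  cancel : ∀ {p q} → suc n × p ≡ suc n × q → p ℚ.≤ q
  cancel {p} {q} eq = *-cancelˡ-≤-pos (suc n × 1ℚ) {{positive n}}
    (≤-reflexive (trans (scale p) (trans eq (sym (scale q)))))

×-∑ : ∀ n {k} (f : Fin k → ℚ) → n × (∑[ i < k ] f i) ≡ ∑[ i < k ] (n × f i)
×-∑ zero    {k} f = sym (∑-zero {k} (λ _ → 0ℚ) (λ _ → refl))
×-∑ (suc n) {k} f = trans (cong (∑[ i < k ] f i +_) (×-∑ n f))
  (sym (∑-distrib-+ {k} f (λ i → n × f i)))

-- The commutative semiring of series.

⊛-sucʳ : ∀ a b n → (a ⊛ b) (suc n) ≡ a (suc n) * b 0 + (a ⊛ tail b) n
⊛-sucʳ a b zero =
  solve 4 (λ x y z t → x :* y :+ (z :* t :+ con 0ℚ) := z :* t :+ (x :* y :+ con 0ℚ))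
    refl (a 0) (b 1) (a 1) (b 0)
  where open +-*-Solver
⊛-sucʳ a b (suc n) = trans
  (cong (a 0 * b (suc (suc n)) +_) (⊛-sucʳ (tail a) b n))
  (solve 3 (λ x y z → x :+ (y :+ z) := y :+ (x :+ z))
    refl (a 0 * b (suc (suc n))) (a (suc (suc n)) * b 0) ((tail a ⊛ tail b) n))
  where open +-*-Solver

-- The left side unfolds by its first summand and the right side, through `⊛-sucʳ`, by its last;
-- both then recurse on `tail a`.
⊛-comm : ∀ a b → a ⊛ b ≗ b ⊛ a
⊛-comm a b zero    = cong (_+ 0ℚ) (*-comm (a 0) (b 0))
⊛-comm a b (suc n) = trans
  (cong₂ _+_ (*-comm (a 0) (b (suc n))) (⊛-comm (tail a) b n))
  (sym (⊛-sucʳ b a n))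

⊛-isCommutativeMonoid : IsCommutativeMonoid _≗_ _⊛_ 1ₛ
⊛-isCommutativeMonoid = isCommutativeMonoidˡ record
  { isSemigroup = record
    { isMagma = record
      { isEquivalence = Pointwise.isEquivalence ℕ (CommutativeMonoid.isEquivalence +-0-commutativeMonoid)
      ; ∙-cong        = ⊛-cong
      }
    ; assoc = ⊛-assoc
    }
  ; identityˡ = ⊛-identityˡ
  ; comm      = ⊛-comm
  }

⊕-⊛-commutativeSemiring : CommutativeSemiring 0ℓ 0ℓ
⊕-⊛-commutativeSemiring = record
  { Carrier = Series
  ; _≈_     = _≗_
  ; _+_     = _⊕_
  ; _*_     = _⊛_
  ; 0#      = 0ₛ
  ; 1#      = 1ₛ
  ; isCommutativeSemiring = isCommutativeSemiringˡ record
    { +-isCommutativeMonoid = Pointwise.isCommutativeMonoid ℕ +-0-isCommutativeMonoid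
    ; *-isCommutativeMonoid = ⊛-isCommutativeMonoid
    ; distribʳ              = λ c a b → ⊛-distribʳ a b c
    ; zeroˡ                 = ⊛-zeroˡ
    }
  }

private
  module S = CommutativeSemiring ⊕-⊛-commutativeSemiring
  module S-Solver = NaturalCoefficients ⊕-⊛-commutativeSemiring

open SemiringMult S.semiring using () renaming (_×_ to _×ₛ_; ×-comm-* to ×ₛ-comm-⊛)

×ₛ-coeff : ∀ k a n → (k ×ₛ a) n ≡ k × a n
×ₛ-coeff zero    a n = refl
×ₛ-coeff (suc k) a n = cong (a n +_) (×ₛ-coeff k a n)

-- Multiplication by powers of x, and composition of powers.

X⊛-tail : ∀ a → a 0 ≡ 0ℚ → X ⊛ tail a ≗ a
X⊛-tail a a₀≡0 zero    = trans (⊛-zero₀ X (tail a) refl) (sym a₀≡0)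
X⊛-tail a a₀≡0 (suc n) = X⊛-suc (tail a) n

X^-⊛-shift : ∀ a {k n} → k ≤ n → (X ^ k ⊛ a) n ≡ a (n ∸ k)
X^-⊛-shift a {n = n} z≤n = ⊛-identityˡ a n
X^-⊛-shift a {suc k} {suc n} (s≤s k≤n) = begin
  ((X ⊛ X ^ k) ⊛ a) (suc n)  ≡⟨ ⊛-assoc X (X ^ k) a (suc n) ⟩
  (X ⊛ (X ^ k ⊛ a)) (suc n)  ≡⟨ X⊛-suc (X ^ k ⊛ a) n ⟩
  (X ^ k ⊛ a) n              ≡⟨ X^-⊛-shift a k≤n ⟩
  a (n ∸ k)                  ∎
  where open ≡-Reasoning

compose-1ₛ : ∀ b → compose 1ₛ b ≗ 1ₛ
compose-1ₛ b n = begin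
  compose 1ₛ b n         ≡⟨ compose-cong b (λ j → *-identityˡ (1ₛ j)) n ⟨
  compose (1ℚ · 1ₛ) b n  ≡⟨ compose-const 1ℚ b n ⟩
  1ℚ * 1ₛ n              ≡⟨ *-identityˡ (1ₛ n) ⟩
  1ₛ n                   ∎
  where open ≡-Reasoning

compose-^ : ∀ a b → b 0 ≡ 0ℚ → ∀ k → compose (a ^ k) b ≗ compose a b ^ k
compose-^ a b b₀≡0 zero    = compose-1ₛ b
compose-^ a b b₀≡0 (suc k) = S.trans (compose-⊛ a (a ^ k) b b₀≡0)
  (⊛-cong {compose a b} (λ _ → refl) (compose-^ a b b₀≡0 k))

-- The operator θ: product, power and chain rules.

θ : Series → Series
θ a n = n × a n

θ-cong : ∀ {a b} → a ≗ b → θ a ≗ θ b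
θ-cong a≗b n = cong (n ×_) (a≗b n)

θ-X : θ X ≗ X
θ-X zero          = refl
θ-X (suc zero)    = refl
θ-X (suc (suc n)) = ×-zeroʳ (suc (suc n))

θ-const : ∀ s → θ (s · 1ₛ) ≗ 0ₛ
θ-const s zero    = refl
θ-const s (suc n) = trans (cong (suc n ×_) (*-zeroʳ s)) (×-zeroʳ (suc n))

X⊛-derivative : ∀ a → X ⊛ derivative a ≗ θ a
X⊛-derivative a zero    = ⊛-zero₀ X (derivative a) refl
X⊛-derivative a (suc n) = X⊛-suc (derivative a) n

-- Since θ preserves degrees, the rule holds summand by summand: the multiplier splits as n = i + (n
-- - i).
θ-⊛ : ∀ a b → θ (a ⊛ b) ≗ (θ a ⊛ b) ⊕ (a ⊛ θ b)
θ-⊛ a b n = begin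
  n × (∑[ i ≤ n ] (a (toℕ i) * b (n ∸ toℕ i)))
    ≡⟨ ×-∑ n {suc n} (λ i → a (toℕ i) * b (n ∸ toℕ i)) ⟩
  (∑[ i ≤ n ] (n × (a (toℕ i) * b (n ∸ toℕ i))))
    ≡⟨ sum-cong-≗ {suc n} (λ i → term (toℕ i) (toℕ≤pred[n] i)) ⟩
  (∑[ i ≤ n ] (θ a (toℕ i) * b (n ∸ toℕ i) + a (toℕ i) * θ b (n ∸ toℕ i)))
    ≡⟨ ∑-distrib-+ {suc n} (λ i → θ a (toℕ i) * b (n ∸ toℕ i)) (λ i → a (toℕ i) * θ b (n ∸ toℕ i)) ⟩
  (θ a ⊛ b) n + (a ⊛ θ b) n ∎
  where
  open ≡-Reasoning
  term : ∀ i → i ≤ n →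
    n × (a i * b (n ∸ i)) ≡ θ a i * b (n ∸ i) + a i * θ b (n ∸ i)
  term i i≤n = begin
    n × (a i * b (n ∸ i))
      ≡⟨ cong (_× (a i * b (n ∸ i))) (ℕ.m+[n∸m]≡n i≤n) ⟨
    (i ℕ.+ (n ∸ i)) × (a i * b (n ∸ i))
      ≡⟨ ℚ×.×-homo-+ (a i * b (n ∸ i)) i (n ∸ i) ⟩
    i × (a i * b (n ∸ i)) + (n ∸ i) × (a i * b (n ∸ i))
      ≡⟨ cong₂ _+_ (ℚ×.×-assoc-* i (a i) (b (n ∸ i))) (ℚ×.×-comm-* (n ∸ i) (a i) (b (n ∸ i))) ⟨
    θ a i * b (n ∸ i) + a i * θ b (n ∸ i) ∎

θ-^ : ∀ a n → θ (a ^ suc n) ≗ suc n ×ₛ (a ^ n ⊛ θ a)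
θ-^ a zero = begin
  θ (a ⊛ 1ₛ)           ≈⟨ θ-cong (S.*-identityʳ a) ⟩
  θ a                  ≈⟨ solve 1 (λ x → x := con 1 :* x :+ con 0) (λ _ → refl) (θ a) ⟩
  (1ₛ ⊛ θ a) ⊕ 0ₛ      ∎
  where
  open SetoidReasoning S.setoid
  open S-Solver
θ-^ a (suc n) = begin
  θ (a ⊛ p)
    ≈⟨ θ-⊛ a p ⟩
  (θ a ⊛ p) ⊕ (a ⊛ θ p)
    ≈⟨ S.+-cong (⊛-comm (θ a) p) (⊛-cong {a} (λ _ → refl) (θ-^ a n)) ⟩
  (p ⊛ θ a) ⊕ (a ⊛ (suc n ×ₛ (a ^ n ⊛ θ a)))
    ≈⟨ S.+-cong {p ⊛ θ a} (λ _ → refl) (S.trans (×ₛ-comm-⊛ (suc n) a (a ^ n ⊛ θ a))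
         (×ₛ-cong (suc n) (S.sym (⊛-assoc a (a ^ n) (θ a))))) ⟩
  (p ⊛ θ a) ⊕ (suc n ×ₛ (p ⊛ θ a)) ∎
  where
  open SetoidReasoning S.setoid
  open SemiringMult S.semiring using () renaming (×-congʳ to ×ₛ-cong)
  p = a ^ suc n

-- The derivative of a₀ + x ā is ā + x ā′; this lets the chain rule recurse on `tail a`.
derivative-tail : ∀ a → derivative a ≗ tail a ⊕ (X ⊛ derivative (tail a))
derivative-tail a n = cong (a (suc n) +_) (sym (X⊛-derivative (tail a) n))

-- The product rule is applied to a(b) = a₀ + b ā(b). As b has no constant term, the coefficient of
-- xⁿ in b θ(ā(b)) involves θ(ā(b)) only below degree n, where the induction hypothesis for ā
-- applies.
θ-compose : ∀ a b → b 0 ≡ 0ℚ → θ (compose a b) ≗ compose (derivative a) b ⊛ θ b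
θ-compose a b b₀≡0 n =
  <-rec (λ n → ∀ a → θ (compose a b) n ≡ (compose (derivative a) b ⊛ θ b) n) step n a
  where
  derivative-horner : ∀ a → compose (derivative a) b
    ≗ compose (tail a) b ⊕ (b ⊛ compose (derivative (tail a)) b)
  derivative-horner a = begin
    compose (derivative a) b
      ≈⟨ compose-cong b (derivative-tail a) ⟩
    compose (tail a ⊕ (X ⊛ derivative (tail a))) b
      ≈⟨ compose-⊕ (tail a) (X ⊛ derivative (tail a)) b ⟩
    compose (tail a) b ⊕ compose (X ⊛ derivative (tail a)) b
      ≈⟨ S.+-cong {compose (tail a) b} (λ _ → refl)
           (S.trans (compose-⊛ X (derivative (tail a)) b b₀≡0)
             (⊛-cong {b′ = compose (derivative (tail a)) b} (compose-identityˡ b b₀≡0) (λ _ → refl))) ⟩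
    compose (tail a) b ⊕ (b ⊛ compose (derivative (tail a)) b) ∎
    where open SetoidReasoning S.setoid

  step : ∀ n → (∀ {m} → m ℕ.< n → ∀ a → θ (compose a b) m ≡ (compose (derivative a) b ⊛ θ b) m) →
         ∀ a → θ (compose a b) n ≡ (compose (derivative a) b ⊛ θ b) n
  step n ih a = begin
    θ (compose a b) n
      ≡⟨ θ-cong (compose-horner a b b₀≡0) n ⟩
    n × (a 0 * 1ₛ n + (b ⊛ c) n)
      ≡⟨ ℚ×.×-distrib-+ (a 0 * 1ₛ n) ((b ⊛ c) n) n ⟩
    θ (a 0 · 1ₛ) n + θ (b ⊛ c) n
      ≡⟨ trans (cong (_+ θ (b ⊛ c) n) (θ-const (a 0) n)) (+-identityˡ (θ (b ⊛ c) n)) ⟩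
    θ (b ⊛ c) n
      ≡⟨ θ-⊛ b c n ⟩
    (θ b ⊛ c) n + (b ⊛ θ c) n
      ≡⟨ cong ((θ b ⊛ c) n +_) (⊛-cong-< b b₀≡0 n (λ m m<n → ih m<n (tail a))) ⟩
    (θ b ⊛ c) n + (b ⊛ (c′ ⊛ θ b)) n
      ≡⟨ solve 4 (λ x y z t → x :* y :+ z :* (t :* x) := (y :+ z :* t) :* x)
           (λ _ → refl) (θ b) c b c′ n ⟩
    ((c ⊕ (b ⊛ c′)) ⊛ θ b) n
      ≡⟨ ⊛-cong {b = θ b} (derivative-horner a) (λ _ → refl) n ⟨
    (compose (derivative a) b ⊛ θ b) n ∎
    where
    open ≡-Reasoning
    open S-Solver
    c  = compose (tail a) b
    c′ = compose (derivative (tail a)) b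

-- Lagrange inversion.

module Lagrange (w f : Series) (w₀≡0 : w 0 ≡ 0ℚ) (f⊛w≗X : f ⊛ w ≗ X) where
  open S-Solver

  f^⊛θw : ∀ m → (f ^ m ⊛ (w ⊛ θ f)) ⊕ (f ^ suc m ⊛ θ w) ≗ X ⊛ f ^ m
  f^⊛θw m = begin
    (p ⊛ (w ⊛ θ f)) ⊕ (f ⊛ p ⊛ θ w)
      ≈⟨ solve 5 (λ p w f θf θw → p :* (w :* θf) :+ f :* p :* θw := (θf :* w :+ f :* θw) :* p)
           (λ _ → refl) p w f (θ f) (θ w) ⟩
    ((θ f ⊛ w) ⊕ (f ⊛ θ w)) ⊛ p
      ≈⟨ ⊛-cong {b = p} (S.trans (S.sym (θ-⊛ f w)) (S.trans (θ-cong f⊛w≗X) θ-X)) (λ _ → refl) ⟩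
    X ⊛ p ∎
    where
    open SetoidReasoning S.setoid
    p = f ^ m

  -- Replacing f w by x leaves the coefficient of xᵐ⁺¹ in fᵐ θf. There the degree equals the
  -- exponent m + 1 in the power rule, so the factor m + 1 stands on both sides and cancels.
  f^⊛w⊛θf-coeff : ∀ m → (f ^ suc m ⊛ (w ⊛ θ f)) (suc (suc m)) ≡ (f ^ suc m) (suc m)
  f^⊛w⊛θf-coeff m = begin
    (f ⊛ p ⊛ (w ⊛ θ f)) (suc (suc m))
      ≡⟨ solve 4 (λ f p w θf → f :* p :* (w :* θf) := f :* w :* (p :* θf))
           (λ _ → refl) f p w (θ f) (suc (suc m)) ⟩
    (f ⊛ w ⊛ (p ⊛ θ f)) (suc (suc m))
      ≡⟨ ⊛-cong {b = p ⊛ θ f} f⊛w≗X (λ _ → refl) (suc (suc m)) ⟩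
    (X ⊛ (p ⊛ θ f)) (suc (suc m))
      ≡⟨ X⊛-suc (p ⊛ θ f) (suc m) ⟩
    (p ⊛ θ f) (suc m)
      ≡⟨ ×-cancelˡ m (trans (sym (×ₛ-coeff (suc m) (p ⊛ θ f) (suc m))) (sym (θ-^ f m (suc m)))) ⟩
    (f ^ suc m) (suc m) ∎
    where
    open ≡-Reasoning
    p = f ^ m

  f^⊛θw-coeff : ∀ m → (f ^ suc m ⊛ θ w) (suc m) ≡ 1ₛ m
  f^⊛θw-coeff zero = begin
    (f ^ 1 ⊛ θ w) 1
      ≡⟨ +-identityˡ _ ⟨
    0ℚ + (f ^ 1 ⊛ θ w) 1
      -- Neither w nor θf has a constant term, so w θf starts in degree 2.
      ≡⟨ cong (_+ (f ^ 1 ⊛ θ w) 1) w⊛θf₁≡0 ⟨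
    (1ₛ ⊛ (w ⊛ θ f)) 1 + (f ^ 1 ⊛ θ w) 1
      ≡⟨ f^⊛θw 0 1 ⟩
    (X ⊛ 1ₛ) 1
      ≡⟨ X⊛-suc 1ₛ 0 ⟩
    1ℚ ∎
    where
    open ≡-Reasoning
    w⊛θf₁≡0 : (1ₛ ⊛ (w ⊛ θ f)) 1 ≡ 0ℚ
    w⊛θf₁≡0 = begin
      (1ₛ ⊛ (w ⊛ θ f)) 1  ≡⟨ ⊛-identityˡ (w ⊛ θ f) 1 ⟩
      (w ⊛ θ f) 1         ≡⟨ ⊛-shift w (θ f) w₀≡0 0 ⟩
      (tail w ⊛ θ f) 0    ≡⟨ ⊛-comm (tail w) (θ f) 0 ⟩
      (θ f ⊛ tail w) 0    ≡⟨ ⊛-zero₀ (θ f) (tail w) refl ⟩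
      0ℚ                  ∎
  -- `d` is both the coefficient contributed by the θf term and that of x fᵐ⁺¹, so nothing is left
  -- for `t`.
  f^⊛θw-coeff (suc m) = ∙-cancelˡ d (t (suc (suc m))) 0ℚ (begin
    d + t (suc (suc m))
      ≡⟨ cong (_+ t (suc (suc m))) (f^⊛w⊛θf-coeff m) ⟨
    (f ^ suc m ⊛ (w ⊛ θ f)) (suc (suc m)) + t (suc (suc m))
      ≡⟨ f^⊛θw (suc m) (suc (suc m)) ⟩
    (X ⊛ f ^ suc m) (suc (suc m))
      ≡⟨ X⊛-suc (f ^ suc m) (suc m) ⟩
    d
      ≡⟨ +-identityʳ d ⟨
    d + 0ℚ ∎)
    where
    open ≡-Reasoning
    open GroupProperties +-0-group using (∙-cancelˡ)
    d = (f ^ suc m) (suc m)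
    t = f ^ suc (suc m) ⊛ θ w

  -- In a(w) = a₀ + w ā(w), the constant is handled by `f^⊛θw-coeff`; in the rest, w absorbs one
  -- factor f and becomes x, which lowers the degree and the exponent of f together.
  lagrange-step : ∀ a n → (compose a w ⊛ θ w ⊛ f ^ suc n) (suc n)
    ≡ a 0 * 1ₛ n + (compose (tail a) w ⊛ θ w ⊛ f ^ n) n
  lagrange-step a n = begin
    (compose a w ⊛ θ w ⊛ f ^ suc n) (suc n)
      ≡⟨ ⊛-cong {b = p} (⊛-cong {b = θ w} (compose-horner a w w₀≡0) (λ _ → refl)) (λ _ → refl) (suc n) ⟩
    (((a 0 · 1ₛ) ⊕ (w ⊛ c)) ⊛ θ w ⊛ (f ⊛ f ^ n)) (suc n)
      ≡⟨ solve 6 (λ s w c θw f p → (s :+ w :* c) :* θw :* (f :* p)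
                                     := s :* (f :* p :* θw) :+ f :* w :* (c :* θw :* p))
           (λ _ → refl) (a 0 · 1ₛ) w c (θ w) f (f ^ n) (suc n) ⟩
    ((a 0 · 1ₛ) ⊛ (p ⊛ θ w)) (suc n) + (f ⊛ w ⊛ r) (suc n)
      ≡⟨ cong₂ _+_
           (trans (·-⊛-assoc (a 0) 1ₛ (p ⊛ θ w) (suc n)) (cong (a 0 *_) (⊛-identityˡ (p ⊛ θ w) (suc n))))
           (trans (⊛-cong {b = r} f⊛w≗X (λ _ → refl) (suc n)) (X⊛-suc r n)) ⟩
    a 0 * (p ⊛ θ w) (suc n) + r n
      ≡⟨ cong (λ z → a 0 * z + r n) (f^⊛θw-coeff n) ⟩
    a 0 * 1ₛ n + r n ∎
    where
    open ≡-Reasoning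
    p = f ^ suc n
    c = compose (tail a) w
    r = c ⊛ θ w ⊛ f ^ n

  -- The series `a` varies in the induction on `n`, since each step passes to `tail a`.
  lagrange : ∀ n a → (compose a w ⊛ θ w ⊛ f ^ suc n) (suc n) ≡ a n
  lagrange zero a = begin
    (compose a w ⊛ θ w ⊛ f ^ 1) 1
      ≡⟨ lagrange-step a 0 ⟩
    a 0 * 1ℚ + (c ⊛ θ w ⊛ 1ₛ) 0
      ≡⟨ cong₂ _+_ (*-identityʳ (a 0))
           -- The remainder vanishes because θw has no constant term.
           (trans (solve 2 (λ x y → x :* y :* con 1 := y :* x) (λ _ → refl) c (θ w) 0)
                  (⊛-zero₀ (θ w) c refl)) ⟩
    a 0 + 0ℚ
      ≡⟨ +-identityʳ (a 0) ⟩
    a 0 ∎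
    where
    open ≡-Reasoning
    c = compose (tail a) w
  lagrange (suc n) a = begin
    (compose a w ⊛ θ w ⊛ f ^ suc (suc n)) (suc (suc n))
      ≡⟨ lagrange-step a (suc n) ⟩
    a 0 * 0ℚ + (compose (tail a) w ⊛ θ w ⊛ f ^ suc n) (suc n)
      ≡⟨ cong₂ _+_ (*-zeroʳ (a 0)) (lagrange n (tail a)) ⟩
    0ℚ + a (suc n)
      ≡⟨ +-identityˡ (a (suc n)) ⟩
    a (suc n) ∎
    where open ≡-Reasoning

-- Application to Riordan arrays.

x/-inverse : ∀ w → (x/ w) ⊛ F₁.series w ≗ X
x/-inverse w = begin
  1ₛ ⊛ recip t ⊛ ŵ
    ≈⟨ ⊛-cong {1ₛ ⊛ recip t} (λ _ → refl) (S.sym (X⊛-tail ŵ (F₁.constant≡0 w))) ⟩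
  1ₛ ⊛ recip t ⊛ (X ⊛ tail ŵ)
    ≈⟨ solve 3 (λ r x y → con 1 :* r :* (x :* y) := r :* y :* x) (λ _ → refl) (recip t) X (tail ŵ) ⟩
  recip t ⊛ tail ŵ ⊛ X
    ≈⟨ ⊛-cong {b = X} (recip-inverse t) (λ _ → refl) ⟩
  1ₛ ⊛ X
    ≈⟨ ⊛-identityˡ X ⟩
  X ∎
  where
  open SetoidReasoning S.setoid
  open S-Solver
  ŵ = F₁.series w
  t : F₀
  t = record { series = tail ŵ ; constant≢0 = F₁.linear≢0 w }

-- The chain rule for v(w) = x reads x = v′(w) θw; dividing by v′(w) isolates θw.
X⊛recip-derivative : ∀ v → X ⊛ recip (v ′ ⟨ Rev v ⟩) ≗ θ (F₁.series (Rev v))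
X⊛recip-derivative v = begin
  X ⊛ r
    ≈⟨ ⊛-cong {b = r} X≗d⊛θw (λ _ → refl) ⟩
  d ⊛ θ w ⊛ r
    ≈⟨ solve 3 (λ x y z → x :* y :* z := z :* x :* y) (λ _ → refl) d (θ w) r ⟩
  r ⊛ d ⊛ θ w
    ≈⟨ ⊛-cong {b = θ w} (recip-inverse (v ′ ⟨ Rev v ⟩)) (λ _ → refl) ⟩
  1ₛ ⊛ θ w
    ≈⟨ ⊛-identityˡ (θ w) ⟩
  θ w ∎
  where
  open SetoidReasoning S.setoid
  open S-Solver
  w = F₁.series (Rev v)
  d = F₀.series (v ′ ⟨ Rev v ⟩)
  r = recip (v ′ ⟨ Rev v ⟩)
  X≗d⊛θw : X ≗ d ⊛ θ w
  X≗d⊛θw = begin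
    X                              ≈⟨ θ-X ⟨
    θ X                            ≈⟨ θ-cong (Rev-inverseʳ v) ⟨
    θ (compose (F₁.series v) w)    ≈⟨ θ-compose (F₁.series v) w (F₁.constant≡0 (Rev v)) ⟩
    d ⊛ θ w                        ∎

proposition6 : (u : F₀) (v : F₁) →
    let f = x/ Rev v
        g = f ⊛ (F₀.series (u ⟨ Rev v ⟩) ⊘ v ′ ⟨ Rev v ⟩)
    in (n k : ℕ) → k ≤ n → riordan u v n k ≡ ([x^ n ∸ k ] (g ⊛ f ^ n))
proposition6 u v n k k≤n = begin
  (û ⊛ v̂ ^ k) n
    ≡⟨ lagrange n (û ⊛ v̂ ^ k) ⟨
  (compose (û ⊛ v̂ ^ k) w ⊛ θ w ⊛ f ^ suc n) (suc n)
    -- Substituting w turns u vᵏ into u(w) xᵏ, and θw is x / v′(w).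
    ≡⟨ ⊛-cong {b = f ^ suc n} (⊛-cong compose-numerator (S.sym (X⊛recip-derivative v))) (λ _ → refl) (suc n) ⟩
  (uw ⊛ X ^ k ⊛ (X ⊛ r) ⊛ (f ⊛ f ^ n)) (suc n)
    -- One factor of fⁿ⁺¹ goes into g. The lone x then takes the degree from n + 1 to n, and xᵏ
    -- takes it to n - k.
    ≡⟨ solve 6 (λ u y x r f p → u :* y :* (x :* r) :* (f :* p) := x :* (y :* (f :* (u :* r) :* p)))
         (λ _ → refl) uw (X ^ k) X r f (f ^ n) (suc n) ⟩
  (X ⊛ (X ^ k ⊛ (f ⊛ (uw ⊛ r) ⊛ f ^ n))) (suc n)
    ≡⟨ X⊛-suc (X ^ k ⊛ (f ⊛ (uw ⊛ r) ⊛ f ^ n)) n ⟩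
  (X ^ k ⊛ (f ⊛ (uw ⊛ r) ⊛ f ^ n)) n
    ≡⟨ X^-⊛-shift (f ⊛ (uw ⊛ r) ⊛ f ^ n) k≤n ⟩
  (f ⊛ (uw ⊛ r) ⊛ f ^ n) (n ∸ k) ∎
  where
  open ≡-Reasoning
  open S-Solver
  û = F₀.series u
  v̂ = F₁.series v
  w = F₁.series (Rev v)
  f = x/ Rev v
  uw = compose û w
  r = recip (v ′ ⟨ Rev v ⟩)
  w₀≡0 = F₁.constant≡0 (Rev v)
  open Lagrange w f w₀≡0 (x/-inverse (Rev v))
  compose-numerator : compose (û ⊛ v̂ ^ k) w ≗ uw ⊛ X ^ k
  compose-numerator = S.trans (compose-⊛ û (v̂ ^ k) w w₀≡0)
    (⊛-cong {uw} (λ _ → refl)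
      (S.trans (compose-^ v̂ w w₀≡0 k) (^-cong (Rev-inverseʳ v) k)))
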